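{- For every integer $k\ge 1$ there exists an acyclic temporal network $N=((V\cup \{s\},A),\tau)$ such that $\lambda_{N}(s,v)\ge k$ for all $v\in V$, but $N$ contains no two arc-disjoint spanning $\tau$-respecting $s$-arborescences.
   Context: A temporal network is a pair $N=(D,\tau)$ where $D=(V\cup\{s\},A)$ is a directed graph (parallel arcs allowed) with root $s$ entered by no arc, and $\tau:A\to\mathbb{N}$; it is acyclic if $D$ has no directed cycle. A directed path with arcs $a_1,\dots,a_\ell$ in order is $\tau$-respecting if $\tau(a_1)\le\dots\le\tau(a_\ell)$; $\lambda_N(s,v)$ is the maximum number of pairwise arc-disjoint $\tau$-respecting $(s,v)$-paths. An $s$-arborescence is an acyclic subgraph $F=(V'\cup\{s\},A')$ in which every vertex of $V'$ has in-degree exactly $1$; it is spanning if $V'=V$, and $\tau$-respecting if every path in $F$ from $s$ is $\tau$-respecting. -}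

module Defs where

open import Data.Bool using (Bool; true; T; T?)
open import Data.Fin using (Fin; finToFun; funToFin)
open import Data.Fin.Properties using (any?; all?; injective⇒≤; finToFun-funToFin) renaming (_≟_ to _≟ᶠ_)
open import Data.List using (List; []; _∷_; length; map; filter; tabulate; lookup; cartesianProductWith)
open import Data.List.Membership.Propositional using (_∈_)
open import Data.List.Membership.Propositional.Properties using (∈-lookup; ∈-tabulate⁺; ∈-cartesianProductWith⁺)
open import Data.List.Relation.Binary.Disjoint.Propositional using (Disjoint)
open import Data.List.Relation.Unary.All using (All)
open import Data.List.Relation.Unary.AllPairs using (_∷_)
open import Data.List.Relation.Unary.Any using (here; there; index)
open import Data.List.Relation.Unary.Any.Properties using (lookup-index)
open import Data.List.Relation.Unary.Linked using (Linked; linked?)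
open import Data.List.Relation.Unary.Unique.Propositional using (Unique)
open import Data.List.Relation.Unary.Unique.Propositional.Properties using (map⁻)
open import Data.Maybe using (Maybe; just; nothing; maybe)
open import Data.Maybe.Properties using (≡-dec)
open import Data.Nat using (ℕ; zero; suc; _≤_; s≤s; _≤?_; _^_)
open import Data.Nat.Properties using (m≤n⇒m<n∨m≡n; ≤-pred)
open import Data.Product using (∃; _×_; _,_; proj₁; proj₂)
open import Data.Sum using (inj₁; inj₂)
open import Function using (_↔_; _∘_; Inverse)
open import Function.Properties.Inverse using (↔⇒↣)
open import Relation.Binary.Definitions using (DecidableEquality)
open import Relation.Binary.PropositionalEquality using (_≡_; _≢_; refl; sym; trans; cong; subst; subst₂)
open import Relation.Nullary using (¬_; Dec; yes; no; ¬?; contradiction)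
open import Relation.Nullary.Decidable using (_×-dec_; _→-dec_; map′; via-injection)
import Data.List.Relation.Binary.Disjoint.DecPropositional as DecDisjoint
import Data.List.Relation.Unary.All as All
import Data.List.Relation.Unary.Unique.DecPropositional as DecUnique

Finite : Set → Set
Finite X = ∃ λ n → X ↔ Fin n

IsMaximum : (ℕ → Set) → ℕ → Set
IsMaximum P m = P m × (∀ l → P l → l ≤ m)

-- V ∪ {s} is encoded as Maybe V, with s = nothing.  Arcs are abstract
-- elements of A with two ends, so parallel arcs are allowed.
record RootedDigraph : Set₁ where
  field
    V A      : Set
    V-finite : Finite V
    A-finite : Finite A

  Vertex : Set
  Vertex = Maybe V

  s : Vertex
  s = nothing

  field
    tail head        : A → Vertex
    root-not-entered : ∀ a → head a ≢ s

  _≟ⱽ_ : DecidableEquality Vertex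
  _≟ⱽ_ = ≡-dec (via-injection (↔⇒↣ (proj₂ V-finite)) _≟ᶠ_)

  _≟ᴬ_ : DecidableEquality A
  _≟ᴬ_ = via-injection (↔⇒↣ (proj₂ A-finite)) _≟ᶠ_

  arcs : List A
  arcs = tabulate (Inverse.from (proj₂ A-finite))

  data IsWalk : Vertex → List A → Vertex → Set where
    []  : ∀ {u} → IsWalk u [] u
    _∷_ : ∀ {u a p v} → tail a ≡ u → IsWalk (head a) p v → IsWalk u (a ∷ p) v

  -- The vertices visited by a walk p starting at u are u ∷ map head p.
  IsPath : Vertex → List A → Vertex → Set
  IsPath u p v = IsWalk u p v × Unique (u ∷ map head p)

  IsCycle : List A → Set
  IsCycle p = p ≢ [] × (∃ λ u → IsWalk u p u) × Unique (map head p)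

  record Subgraph : Set where
    field
      V′     : V → Bool
      A′     : A → Bool

    -- the vertex set V′ ∪ {s}
    vertices : Vertex → Bool
    vertices = maybe V′ true

    field
      closed : ∀ a → T (A′ a) → T (vertices (tail a)) × T (vertices (head a))

    inDegree : Vertex → ℕ
    inDegree v = length (filter (λ a → T? (A′ a) ×-dec (head a ≟ⱽ v)) arcs)

    Contains : List A → Set
    Contains = All (T ∘ A′)

  open Subgraph

  IsArborescence : Subgraph → Set
  IsArborescence F =
    (∀ p → Contains F p → ¬ IsCycle p) × (∀ v → T (V′ F v) → inDegree F (just v) ≡ 1)

  IsSpanning : Subgraph → Set
  IsSpanning F = ∀ v → T (V′ F v)

  ArcDisjoint : Subgraph → Subgraph → Set
  ArcDisjoint F G = ∀ a → ¬ (T (A′ F a) × T (A′ G a))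

record TemporalNetwork : Set₁ where
  field
    D : RootedDigraph

  open RootedDigraph D public

  field
    τ : A → ℕ

  Acyclic : Set
  Acyclic = ∀ p → ¬ IsCycle p

  Respecting : List A → Set
  Respecting = Linked (λ a b → τ a ≤ τ b)

  IsRespectingSubgraph : Subgraph → Set
  IsRespectingSubgraph F =
    ∀ p v → Subgraph.Contains F p → IsPath s p v → Respecting p

  IsSpanningRespectingArborescence : Subgraph → Set
  IsSpanningRespectingArborescence F =
    IsArborescence F × IsSpanning F × IsRespectingSubgraph F

  IsRespectingPath : V → List A → Set
  IsRespectingPath v p = IsPath s p (just v) × Respecting p

  IsPacking : V → (l : ℕ) → (Fin l → List A) → Set
  IsPacking v l ps =
    (∀ i → IsRespectingPath v (ps i)) × (∀ i j → i ≢ j → Disjoint (ps i) (ps j))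

  HasPacking : V → ℕ → Set
  HasPacking v l = ∃ (IsPacking v l)

-- The maximum size of a packing exists: sizes are bounded by the number of
-- arcs, and the existence of a packing of a given size is decidable.
module Connectivity (N : TemporalNetwork) where
  open TemporalNetwork N

  private
    ∣A∣ : ℕ
    ∣A∣ = proj₁ A-finite

    ix : A → Fin ∣A∣
    ix = Inverse.to (proj₂ A-finite)

    ix-injective : ∀ {a b} → ix a ≡ ix b → a ≡ b
    ix-injective {a} {b} eq = trans (sym (back a)) (trans (cong from eq) (back b))
      where
      from : Fin ∣A∣ → A
      from = Inverse.from (proj₂ A-finite)
      back : ∀ x → from (ix x) ≡ x
      back = Inverse.strictlyInverseʳ (proj₂ A-finite)

    ∈-arcs : ∀ a → a ∈ arcs
    ∈-arcs a = subst (_∈ arcs) (Inverse.strictlyInverseʳ (proj₂ A-finite) a) (∈-tabulate⁺ (ix a))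

    isWalk? : ∀ u p v → Dec (IsWalk u p v)
    isWalk? u [] v = map′ (λ { refl → [] }) (λ { [] → refl }) (u ≟ⱽ v)
    isWalk? u (a ∷ p) v =
      map′ (λ { (e , w) → e ∷ w }) (λ { (e ∷ w) → e , w })
        ((tail a ≟ⱽ u) ×-dec isWalk? (head a) p v)

    isRespectingPath? : ∀ v p → Dec (IsRespectingPath v p)
    isRespectingPath? v p =
      (isWalk? s p (just v) ×-dec DecUnique.unique? _≟ⱽ_ (s ∷ map head p))
        ×-dec linked? (λ a b → τ a ≤? τ b) p

    isPacking? : ∀ v l ps → Dec (IsPacking v l ps)
    isPacking? v l ps =
      all? (λ i → isRespectingPath? v (ps i)) ×-dec
      all? (λ i → all? λ j → ¬? (i ≟ᶠ j) →-dec DecDisjoint.disjoint? _≟ᴬ_ (ps i) (ps j))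

    lookup-inj : ∀ {p : List A} → Unique p → ∀ i j → lookup p i ≡ lookup p j → i ≡ j
    lookup-inj (_ ∷ _)  Fin.zero    Fin.zero    _  = refl
    lookup-inj (x∉ ∷ _) Fin.zero    (Fin.suc j) eq = contradiction eq (All.lookup x∉ (∈-lookup j))
    lookup-inj (x∉ ∷ _) (Fin.suc i) Fin.zero    eq = contradiction (sym eq) (All.lookup x∉ (∈-lookup i))
    lookup-inj (_ ∷ u)  (Fin.suc i) (Fin.suc j) eq = cong Fin.suc (lookup-inj u i j eq)

    path-length : ∀ {v p} → IsRespectingPath v p → length p ≤ ∣A∣
    path-length {p = p} ((_ , (_ ∷ u)) , _) =
      injective⇒≤ {f = ix ∘ lookup p} (λ eq → lookup-inj (map⁻ u) _ _ (ix-injective eq))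

    lists : ℕ → List (List A)
    lists zero    = [] ∷ []
    lists (suc n) = [] ∷ cartesianProductWith _∷_ arcs (lists n)

    ∈-lists : ∀ n p → length p ≤ n → p ∈ lists n
    ∈-lists zero    []      _       = here refl
    ∈-lists (suc n) []      _       = here refl
    ∈-lists (suc n) (a ∷ p) (s≤s h) = there (∈-cartesianProductWith⁺ _∷_ (∈-arcs a) (∈-lists n p h))

    candidates : List (List A)
    candidates = lists ∣A∣

    decode : ∀ l → Fin (length candidates ^ l) → Fin l → List A
    decode l c i = lookup candidates (finToFun {length candidates} {l} c i)

    transport : ∀ {v l ps qs} → (∀ i → ps i ≡ qs i) → IsPacking v l ps → IsPacking v l qs
    transport {v} eq (paths , disj) =
      (λ i → subst (IsRespectingPath v) (eq i) (paths i)) ,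
      (λ i j i≢j → subst₂ Disjoint (eq i) (eq j) (disj i j i≢j))

    encode : ∀ {v} l → HasPacking v l → ∃ λ c → IsPacking v l (decode l c)
    encode l (ps , pk) = funToFin code , transport eq pk
      where
      mem : ∀ i → ps i ∈ candidates
      mem i = ∈-lists ∣A∣ (ps i) (path-length (proj₁ pk i))
      code : Fin l → Fin (length candidates)
      code = index ∘ mem
      eq : ∀ i → ps i ≡ decode l (funToFin code) i
      eq i = trans (lookup-index (mem i)) (cong (lookup candidates) (sym (finToFun-funToFin code i)))

    hasPacking? : ∀ v l → Dec (HasPacking v l)
    hasPacking? v l =
      map′ (λ { (c , pk) → decode l c , pk }) (encode l)
        (any? (λ c → isPacking? v l (decode l c)))

    firstArc : ∀ {v p} → IsRespectingPath v p → ∃ (_∈ p)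
    firstArc {p = a ∷ _} _ = a , here refl
    firstArc {p = []} ((() , _) , _)

    packing-bound : ∀ v l → HasPacking v l → l ≤ ∣A∣
    packing-bound v l (ps , paths , disj) = injective⇒≤ {f = ix ∘ first} injective
      where
      first : Fin l → A
      first i = proj₁ (firstArc (paths i))
      injective : ∀ {i j} → ix (first i) ≡ ix (first j) → i ≡ j
      injective {i} {j} eq with i ≟ᶠ j
      ... | yes i≡j = i≡j
      ... | no  i≢j = contradiction
        (proj₂ (firstArc (paths i)) ,
         subst (_∈ ps j) (sym (ix-injective eq)) (proj₂ (firstArc (paths j))))
        (disj i j i≢j)

    maximum : (P : ℕ → Set) → (∀ l → Dec (P l)) → P 0 →
              ∀ b → (∀ l → P l → l ≤ b) → ∃ (IsMaximum P)
    maximum P P? P0 zero    bound = 0 , P0 , bound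
    maximum P P? P0 (suc b) bound with P? (suc b)
    ... | yes Pb = suc b , Pb , bound
    ... | no ¬Pb = maximum P P? P0 b bound′
      where
      bound′ : ∀ l → P l → l ≤ b
      bound′ l Pl with m≤n⇒m<n∨m≡n (bound l Pl)
      ... | inj₁ l<1+b = ≤-pred l<1+b
      ... | inj₂ refl  = contradiction Pl ¬Pb

  abstract
    maximumPacking : ∀ v → ∃ (IsMaximum (HasPacking v))
    maximumPacking v =
      maximum (HasPacking v) (hasPacking? v) ((λ ()) , (λ ()) , (λ ())) ∣A∣ (packing-bound v)

-- λ_N(s,v)
connectivity : (N : TemporalNetwork) → TemporalNetwork.V N → ℕ
connectivity N v = proj₁ (Connectivity.maximumPacking N v)

connectivity-isMaximum : ∀ N v → IsMaximum (TemporalNetwork.HasPacking N v) (connectivity N v)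
connectivity-isMaximum N v = proj₂ (Connectivity.maximumPacking N v)

{-# OPTIONS --safe #-}
-- Take a hypergraph with edges of size k in which any two transversals
-- intersect.  Give every point u exactly k arcs from s, with times 0, …, k − 1,
-- and every edge e one arc of time 0 from each of its k points.  Both kinds of
-- vertices have connectivity k, but a τ-respecting arborescence can continue
-- from u to an edge only if it enters u through the arc of time 0.  The points
-- entered at time 0 by a spanning arborescence thus form a transversal, and
-- arc-disjoint arborescences give disjoint transversals.
--
-- Such a hypergraph is the k × k grid whose edges are the columns and the graphs
-- of all maps from columns to rows: if Q meets every column, then the map
-- choosing a point of Q in each column is an edge avoided by any P disjoint
-- from Q.
module Submission where

open import Defs
open import Data.Bool using (T; T?)
open import Data.Fin using (Fin; zero; toℕ; fromℕ<; finToFun; funToFin)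
open import Data.Fin.Properties using (*↔×; +↔⊎; toℕ-injective; finToFun-funToFin)
open import Data.List using (List; []; _∷_; filter; map)
open import Data.List.Membership.Propositional using (_∈_)
open import Data.List.Membership.Propositional.Properties using (∈-filter⁻; ∈-lookup)
open import Data.List.Relation.Unary.All as All using ([]; _∷_)
open import Data.List.Relation.Unary.AllPairs as AllPairs using (_∷_)
open import Data.List.Relation.Unary.Any using (here; there)
open import Data.List.Relation.Unary.Linked as Linked using (Linked; [-]; _∷_)
open import Data.List.Relation.Unary.Linked.Properties using (Linked⇒AllPairs)
open import Data.Maybe using (just; nothing)
open import Data.Nat using (ℕ; suc; _≤_; _<_; _≥_; _*_; _^_; _+_; s≤s; z≤n)
open import Data.Nat.Properties using (≤-reflexive; n≤0⇒n≡0; <-strictPartialOrder)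
open import Data.Product using (Σ; ∃; ∃₂; _×_; _,_; proj₁; proj₂)
open import Data.Product.Function.NonDependent.Propositional using (_×-↔_)
open import Data.Product.Properties using (,-injectiveˡ; ,-injectiveʳ)
open import Data.Sum using (_⊎_; inj₁; inj₂; [_,_])
open import Data.Sum.Function.Propositional using (_⊎-↔_)
open import Data.Sum.Properties using (inj₁-injective)
open import Function using (_on_)
open import Function.Definitions using (Injective)
open import Function.Properties.Inverse using (↔-refl; ↔-sym; ↔-trans)
open import Level using (0ℓ)
open import Relation.Binary.Bundles using (StrictPartialOrder)
open import Relation.Binary.PropositionalEquality using (_≡_; _≢_; refl; sym; subst)
open import Relation.Nullary using (¬_; Dec)
open import Relation.Nullary.Decidable using (_×-dec_)
open import Relation.Unary using (Pred; _≬_)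

Fin-finite : ∀ n → Finite (Fin n)
Fin-finite n = n , ↔-refl

×-finite : ∀ {X Y} → Finite X → Finite Y → Finite (X × Y)
×-finite (m , f) (n , g) = m * n , ↔-trans (f ×-↔ g) (↔-sym *↔×)

⊎-finite : ∀ {X Y} → Finite X → Finite Y → Finite (X ⊎ Y)
⊎-finite (m , f) (n , g) = m + n , ↔-trans (f ⊎-↔ g) (↔-sym +↔⊎)

module _ (D : RootedDigraph) where
  open RootedDigraph D
  open Subgraph

  inDegree>0⇒enteringArc : ∀ F v → 0 < inDegree F v → ∃ λ a → T (A′ F a) × head a ≡ v
  inDegree>0⇒enteringArc F v 0<d =
    _ , proj₂ (∈-filter⁻ enters? {xs = arcs} (∈-lookup {xs = filter enters? arcs} (fromℕ< 0<d)))
    where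
    enters? : ∀ a → Dec (T (A′ F a) × head a ≡ v)
    enters? a = T? (A′ F a) ×-dec (head a ≟ⱽ v)

  spanningArborescence-enters : ∀ F → IsArborescence F → IsSpanning F →
                                ∀ v → ∃ λ a → T (A′ F a) × head a ≡ just v
  spanningArborescence-enters F (_ , inDegree≡1) spanning v =
    inDegree>0⇒enteringArc F (just v) (≤-reflexive (sym (inDegree≡1 v (spanning v))))

  walk-end∈heads : ∀ {u a p v} → IsWalk u (a ∷ p) v → v ∈ map head (a ∷ p)
  walk-end∈heads (_ ∷ [])        = here refl
  walk-end∈heads (_ ∷ w@(_ ∷ _)) = there (walk-end∈heads w)

  walks-are-paths⇒acyclic : (∀ {u p v} → IsWalk u p v → IsPath u p v) → ∀ p → ¬ IsCycle p
  walks-are-paths⇒acyclic _         []      (p≢[] , _)        = p≢[] refl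
  walks-are-paths⇒acyclic walk⇒path (_ ∷ _) (_ , (_ , w) , _) with walk⇒path w
  ... | _ , u∉heads ∷ _ = All.lookup u∉heads (walk-end∈heads w) refl

  module _ {c ℓ₁ ℓ₂} (O : StrictPartialOrder c ℓ₁ ℓ₂) where
    open StrictPartialOrder O renaming (_<_ to _≺_)

    module Ranked
      (rank : Vertex → Carrier) (rank-increasing : ∀ a → rank (tail a) ≺ rank (head a))
      where

      walk-rank-increasing : ∀ {u p v} → IsWalk u p v → Linked (_≺_ on rank) (u ∷ map head p)
      walk-rank-increasing []         = [-]
      walk-rank-increasing (refl ∷ w) = rank-increasing _ ∷ walk-rank-increasing w

      walk⇒path : ∀ {u p v} → IsWalk u p v → IsPath u p v
      walk⇒path w = w , AllPairs.map ≺⇒≢ (Linked⇒AllPairs trans (walk-rank-increasing w))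
        where
        ≺⇒≢ : ∀ {x y} → rank x ≺ rank y → x ≢ y
        ≺⇒≢ x≺y refl = irrefl Eq.refl x≺y

      acyclic : ∀ p → ¬ IsCycle p
      acyclic = walks-are-paths⇒acyclic walk⇒path

packing⇒connectivity≥ : ∀ N v {l} → TemporalNetwork.HasPacking N v l → connectivity N v ≥ l
packing⇒connectivity≥ N v = proj₂ (connectivity-isMaximum N v) _

record UniformHypergraph (r : ℕ) : Set₁ where
  field
    Point Edge      : Set
    Point-finite    : Finite Point
    Edge-finite     : Finite Edge
    point           : Edge → Fin r → Point
    point-injective : ∀ e → Injective _≡_ _≡_ (point e)

  Transversal : Pred Point 0ℓ → Set
  Transversal P = ∀ e → ∃ λ i → P (point e i)

  TransversalsIntersect : Set₁
  TransversalsIntersect = ∀ P Q → Transversal P → Transversal Q → P ≬ Q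

module HypergraphNetwork {r : ℕ} (H : UniformHypergraph r) (n : ℕ) where
  open UniformHypergraph H

  pattern pointVertex u = just (inj₁ u)
  pattern edgeVertex e  = just (inj₂ e)
  pattern rootArc u t   = inj₁ (u , t)
  pattern edgeArc e i   = inj₂ (e , i)

  digraph : RootedDigraph
  digraph .RootedDigraph.V                  = Point ⊎ Edge
  digraph .RootedDigraph.A                  = (Point × Fin (suc n)) ⊎ (Edge × Fin r)
  digraph .RootedDigraph.V-finite           = ⊎-finite Point-finite Edge-finite
  digraph .RootedDigraph.A-finite           =
    ⊎-finite (×-finite Point-finite (Fin-finite (suc n))) (×-finite Edge-finite (Fin-finite r))
  digraph .RootedDigraph.tail (rootArc u t) = nothing
  digraph .RootedDigraph.tail (edgeArc e i) = pointVertex (point e i)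
  digraph .RootedDigraph.head (rootArc u t) = pointVertex u
  digraph .RootedDigraph.head (edgeArc e i) = edgeVertex e
  digraph .RootedDigraph.root-not-entered (rootArc _ _) ()
  digraph .RootedDigraph.root-not-entered (edgeArc _ _) ()

  network : TemporalNetwork
  network .TemporalNetwork.D               = digraph
  network .TemporalNetwork.τ (rootArc u t) = toℕ t
  network .TemporalNetwork.τ (edgeArc e i) = 0

  open TemporalNetwork network
  open Subgraph

  distanceFromRoot : Vertex → ℕ
  distanceFromRoot nothing         = 0
  distanceFromRoot (pointVertex _) = 1
  distanceFromRoot (edgeVertex _)  = 2

  distanceFromRoot-increasing : ∀ a → distanceFromRoot (tail a) < distanceFromRoot (head a)
  distanceFromRoot-increasing (rootArc _ _) = s≤s z≤n
  distanceFromRoot-increasing (edgeArc _ _) = s≤s (s≤s z≤n)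

  open Ranked digraph <-strictPartialOrder distanceFromRoot distanceFromRoot-increasing public
    using (walk⇒path; acyclic)

  connectivity-point≥ : ∀ u → connectivity network (inj₁ u) ≥ suc n
  connectivity-point≥ u = packing⇒connectivity≥ network (inj₁ u)
    ( (λ t → rootArc u t ∷ [])
    , (λ t → walk⇒path (refl ∷ []) , [-])
    , (λ { i j i≢j (here refl , here refl) → i≢j refl }))

  edgePath : (e : Edge) → Fin r → Fin (suc n) → List A
  edgePath e i t = rootArc (point e i) t ∷ edgeArc e i ∷ []

  edgePath-isPath : ∀ e i t → IsPath s (edgePath e i t) (edgeVertex e)
  edgePath-isPath e i t = walk⇒path (refl ∷ refl ∷ [])

  common-arc⇒same-index : ∀ e {i j t t′ a} →
                          a ∈ edgePath e i t → a ∈ edgePath e j t′ → i ≡ j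
  common-arc⇒same-index e (here refl)         (here eq)           =
    point-injective e (,-injectiveˡ (inj₁-injective eq))
  common-arc⇒same-index e (there (here refl)) (there (here refl)) = refl
  common-arc⇒same-index e (here refl)         (there (here ()))
  common-arc⇒same-index e (there (here refl)) (here ())

  connectivity-edge≥ : ∀ e → connectivity network (inj₂ e) ≥ r
  connectivity-edge≥ e = packing⇒connectivity≥ network (inj₂ e)
    ( (λ i → edgePath e i zero)
    , (λ i → edgePath-isPath e i zero , z≤n ∷ [-])
    , (λ i j i≢j (a∈pᵢ , a∈pⱼ) → i≢j (common-arc⇒same-index e a∈pᵢ a∈pⱼ)))

  module _ (F : Subgraph) where

    EnteredAtTimeZero : Pred Point 0ℓ
    EnteredAtTimeZero u = T (A′ F (rootArc u zero))

    continued⇒enteredAtTimeZero : IsRespectingSubgraph F → ∀ {e i t} →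
      T (A′ F (rootArc (point e i) t)) → T (A′ F (edgeArc e i)) →
      EnteredAtTimeZero (point e i)
    continued⇒enteredAtTimeZero respecting {e} {i} {t} ut∈F ei∈F =
      subst (λ t′ → T (A′ F (rootArc (point e i) t′))) (toℕ-injective (n≤0⇒n≡0 t≤0)) ut∈F
      where
      t≤0 : toℕ t ≤ 0
      t≤0 = Linked.head
        (respecting (edgePath e i t) (edgeVertex e) (ut∈F ∷ ei∈F ∷ []) (edgePath-isPath e i t))

    module _ (arborescence : IsArborescence F) (spanning : IsSpanning F) where

      point-entered : ∀ u → ∃ λ t → T (A′ F (rootArc u t))
      point-entered u with spanningArborescence-enters digraph F arborescence spanning (inj₁ u)
      ... | rootArc _ t , ut∈F , refl = t , ut∈F

      edge-entered : ∀ e → ∃ λ i → T (A′ F (edgeArc e i))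
      edge-entered e with spanningArborescence-enters digraph F arborescence spanning (inj₂ e)
      ... | edgeArc _ i , ei∈F , refl = i , ei∈F

    enteredAtTimeZero-transversal : IsSpanningRespectingArborescence F →
                                    Transversal EnteredAtTimeZero
    enteredAtTimeZero-transversal (arborescence , spanning , respecting) e =
      let i , ei∈F = edge-entered arborescence spanning e
          t , ut∈F = point-entered arborescence spanning (point e i)
      in i , continued⇒enteredAtTimeZero respecting ut∈F ei∈F

  no-disjoint-arborescences : TransversalsIntersect →
    ¬ (∃₂ λ (F₁ F₂ : Subgraph) →
         IsSpanningRespectingArborescence F₁
         × IsSpanningRespectingArborescence F₂
         × ArcDisjoint F₁ F₂)
  no-disjoint-arborescences intersect (F₁ , F₂ , arb₁ , arb₂ , disjoint) =
    let u , u∈₁ , u∈₂ = intersect (EnteredAtTimeZero F₁) (EnteredAtTimeZero F₂)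
                          (enteredAtTimeZero-transversal F₁ arb₁)
                          (enteredAtTimeZero-transversal F₂ arb₂)
    in disjoint (rootArc u zero) (u∈₁ , u∈₂)

module Grid (k : ℕ) where

  Cell : Set
  Cell = Fin k × Fin k

  -- Maps are coded by numbers, as the type Fin k → Fin k cannot be shown finite
  -- without function extensionality.
  Line : Set
  Line = Fin k ⊎ Fin (k ^ k)

  pattern column c    = inj₁ c
  pattern graphCode f = inj₂ f

  cell : Line → Fin k → Cell
  cell (column c)    i = c , i
  cell (graphCode f) c = c , finToFun f c

  cell-injective : ∀ l → Injective _≡_ _≡_ (cell l)
  cell-injective (column _)    = ,-injectiveʳ
  cell-injective (graphCode _) = ,-injectiveˡ

  hypergraph : UniformHypergraph k
  hypergraph = record
    { Point-finite    = ×-finite (Fin-finite k) (Fin-finite k)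
    ; Edge-finite     = ⊎-finite (Fin-finite k) (Fin-finite (k ^ k))
    ; point           = cell
    ; point-injective = cell-injective
    }

  open UniformHypergraph hypergraph using (Transversal; TransversalsIntersect)

  transversal-meets-graph : ∀ P → Transversal P → (f : Fin k → Fin k) → ∃ λ c → P (c , f c)
  transversal-meets-graph P meets f =
    let c , Pcf = meets (graphCode (funToFin f))
    in c , subst (λ i → P (c , i)) (finToFun-funToFin f c) Pcf

  transversalsIntersect : TransversalsIntersect
  transversalsIntersect P Q P-meets Q-meets =
    let c , Pc = transversal-meets-graph P P-meets choice
    in (c , choice c) , Pc , proj₂ (Q-meets (column c))
    where
    choice : Fin k → Fin k
    choice c = proj₁ (Q-meets (column c))

theorem11 : (k : ℕ) → k ≥ 1 →
    Σ TemporalNetwork λ N → let open TemporalNetwork N in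
      Acyclic
      × ((v : V) → connectivity N v ≥ k)
      × ¬ (∃₂ λ (F₁ F₂ : Subgraph) →
             IsSpanningRespectingArborescence F₁
             × IsSpanningRespectingArborescence F₂
             × ArcDisjoint F₁ F₂)
theorem11 k@(suc n) _ =
  network , acyclic , [ connectivity-point≥ , connectivity-edge≥ ] ,
  no-disjoint-arborescences transversalsIntersect
  where
  open Grid k
  open HypergraphNetwork hypergraph n
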